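{- Let $G$ be a finite simple $r$-regular graph. Then $\chi_2(G)-\chi(G)\le 2\lfloor \log_2 \alpha(G)\rfloor+3$.
   Context: $\chi(G)$ is the chromatic number and $\alpha(G)$ the independence number of $G$. A dynamic coloring of $G$ is a proper vertex coloring such that for every vertex $v$ of degree at least $2$, the neighbours of $v$ receive at least two different colors; $\chi_2(G)$ is the smallest number of colors in a dynamic coloring of $G$. -}

module Defs where

open import Data.Nat using (ℕ; _≤_; _<_)
open import Data.Fin using (Fin)
open import Data.Bool using (Bool; true; false)
open import Data.List using (List; filter; length)
open import Data.Fin.Subset using (Subset; _∈_; ∣_∣)
open import Data.Vec using (allFin; toList)
open import Data.Product using (Σ; _×_; ∃)
open import Relation.Binary.PropositionalEquality using (_≡_; _≢_)
open import Data.Bool.Properties using (T?)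
open import Data.Bool using (T)
open import Relation.Nullary using (¬_)

record Graph (n : ℕ) : Set where
  field
    adj   : Fin n → Fin n → Bool
    sym   : ∀ u v → adj u v ≡ adj v u
    irrefl : ∀ v → adj v v ≡ false

open Graph public

Adj : ∀ {n} → Graph n → Fin n → Fin n → Set
Adj G u v = T (adj G u v)

neighbours : ∀ {n} → Graph n → Fin n → List (Fin n)
neighbours G v = filter (λ u → T? (adj G v u)) (toList (allFin _))

degree : ∀ {n} → Graph n → Fin n → ℕ
degree G v = length (neighbours G v)

Regular : ∀ {n} → Graph n → ℕ → Set
Regular G r = ∀ v → degree G v ≡ r

IsProperColoring : ∀ {n} → Graph n → (k : ℕ) → (Fin n → Fin k) → Set
IsProperColoring G k c = ∀ u v → Adj G u v → c u ≢ c v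

IsDynamicColoring : ∀ {n} → Graph n → (k : ℕ) → (Fin n → Fin k) → Set
IsDynamicColoring G k c =
  IsProperColoring G k c ×
  (∀ v → 2 ≤ degree G v →
     Σ (Fin _) λ u → Σ (Fin _) λ w → Adj G v u × Adj G v w × c u ≢ c w)

Colorable : ∀ {n} → Graph n → ℕ → Set
Colorable G k = Σ (Fin _ → Fin k) (IsProperColoring G k)

DynColorable : ∀ {n} → Graph n → ℕ → Set
DynColorable G k = Σ (Fin _ → Fin k) (IsDynamicColoring G k)

IsChromaticNumber : ∀ {n} → Graph n → ℕ → Set
IsChromaticNumber G k = Colorable G k × (∀ m → Colorable G m → k ≤ m)

IsDynamicChromaticNumber : ∀ {n} → Graph n → ℕ → Set
IsDynamicChromaticNumber G k = DynColorable G k × (∀ m → DynColorable G m → k ≤ m)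

IsIndependent : ∀ {n} → Graph n → Subset n → Set
IsIndependent G S = ∀ u v → u ∈ S → v ∈ S → ¬ Adj G u v

IsIndependenceNumber : ∀ {n} → Graph n → ℕ → Set
IsIndependenceNumber {n} G k =
  (Σ (Subset n) λ S → IsIndependent G S × ∣ S ∣ ≡ k) ×
  (∀ S → IsIndependent G S → ∣ S ∣ ≤ k)

{-# OPTIONS --safe #-}
-- Let L = ⌊log₂ α⌋, and call a vertex bad for a proper colouring if its neighbourhood is
-- monochromatic; every proper colouring has at most 2α < 2 ^ (L + 2) bad vertices.
-- If r ≤ L + 2, a greedy dynamic colouring with 2r + 1 ≤ χ + 2L + 3 colours exists.
-- Otherwise start from an optimal proper colouring.  For any set B of vertices, some independent
-- set meets N(v) for at least half of the v ∈ B, so giving new colours to L + 1 such sets leaves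
-- at most one bad vertex with no recoloured neighbour, and a single recoloured vertex deals with
-- that one.  The neighbourhoods that are still monochromatic are fewer than 2 ^ (r - 1) sets of
-- size r, so some Y splits them all, and it is enough to give the vertices of Y in each of the
-- L + 1 recoloured sets a further new colour.
module Submission where

open import Defs
open import Data.Nat using (ℕ; _≤_; _+_; _*_; _∸_)
open import Data.Nat.Logarithm using (⌊log₂_⌋)

open import Data.Bool using (Bool; true; false; T; not; _∧_; _∨_; if_then_else_)
open import Data.Bool.Properties using (T?)
open import Data.Empty using (⊥-elim)
open import Data.Fin using (Fin; zero; suc; fromℕ; inject₁; _↑ˡ_; _↑ʳ_; splitAt)
import Data.Fin as Fin
open import Data.Fin.Properties
  using (_≟_; any?; injective⇒≤; ¬∀⟶∃¬; inject₁-injective; fromℕ≢inject₁; splitAt-↑ˡ; splitAt-↑ʳ)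
import Data.Fin.Properties as Fin
open import Data.Fin.Subset using (∣_∣; _∈_)
open import Data.List as List using (List; []; _∷_; _++_; filter; length)
import Data.List.Membership.DecPropositional as DecMembership
import Data.List.Membership.Propositional as List
open import Data.List.Membership.Propositional.Properties
  using (∈-filter⁺; ∈-filter⁻; ∈-allFin; ∈-map⁺; ∈-++⁺ˡ; ∈-++⁺ʳ)
open import Data.List.Properties using (length-map; length-++)
open import Data.List.Relation.Unary.All using (_∷_)
open import Data.List.Relation.Unary.AllPairs using (_∷_)
open import Data.List.Relation.Unary.Any using (here; there; index)
open import Data.List.Relation.Unary.Any.Properties using (lookup-index)
open import Data.List.Relation.Unary.Unique.Propositional using (Unique)
import Data.List.Relation.Unary.Unique.Propositional.Properties as Unique
open import Data.Maybe as Maybe using (Maybe; just; nothing)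
open import Data.Nat using (zero; suc; _<_; _^_; z≤n; s≤s)
open import Data.Nat.Logarithm using (⌊log₂⌋-mono-≤; ⌊log₂[2^n]⌋≡n)
open import Data.Nat.Properties hiding (_≟_)
open import Algebra.Properties.Semiring.Sum +-*-semiring
  using (sum; sum-cong-≗; ∑-distrib-+; ∑-comm; *-distribˡ-sum; *-distribʳ-sum)
open import Data.Nat.Solver using (module +-*-Solver)
open import Data.Product using (Σ; ∃; _×_; _,_; proj₁; proj₂)
open import Data.Sum using (_⊎_; inj₁; inj₂)
import Data.Vec as Vec
open import Data.Vec.Properties using ([]=⇒lookup; lookup∘tabulate)
open import Function using (_∘_; id)
open import Relation.Binary.Definitions using (tri<; tri≈; tri>)
open import Relation.Binary.PropositionalEquality
  using (_≡_; _≢_; refl; trans; cong; cong₂; subst; subst₂)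
  renaming (sym to ≡-sym)
open import Relation.Nullary using (¬_; Dec; yes; no; does; ¬?)
open import Relation.Nullary.Decidable using (dec-true; dec-false; decidable-stable; _×-dec_)

private variable
  n : ℕ

-- Finite sums and counts of Boolean predicates.

sum-mono : {f g : Fin n → ℕ} → (∀ i → f i ≤ g i) → sum f ≤ sum g
sum-mono {zero}  f≤g = z≤n
sum-mono {suc _} f≤g = +-mono-≤ (f≤g zero) (sum-mono (f≤g ∘ suc))

sum-vanishes : {f : Fin n → ℕ} → (∀ i → f i ≡ 0) → sum f ≡ 0
sum-vanishes {zero}  f≡0 = refl
sum-vanishes {suc _} f≡0 = cong₂ _+_ (f≡0 zero) (sum-vanishes (f≡0 ∘ suc))

term≤sum : (f : Fin n → ℕ) → ∀ i → f i ≤ sum f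
term≤sum f zero    = m≤m+n _ _
term≤sum f (suc i) = ≤-trans (term≤sum (f ∘ suc) i) (m≤n+m _ _)

⟦_⟧ : Bool → ℕ
⟦ true ⟧  = 1
⟦ false ⟧ = 0

count : (Fin n → Bool) → ℕ
count p = sum (⟦_⟧ ∘ p)

_∖_ _∩_ : (A H : Fin n → Bool) → Fin n → Bool
(A ∖ H) v = A v ∧ not (H v)
(A ∩ H) v = A v ∧ H v

∖-≤ : ∀ (A H : Fin n → Bool) v → ⟦ (A ∖ H) v ⟧ ≤ ⟦ A v ⟧
∖-≤ A H v with A v | H v
... | true  | true  = z≤n
... | true  | false = ≤-refl
... | false | _     = z≤n

∣tabulate∣ : (p : Fin n → Bool) → ∣ Vec.tabulate p ∣ ≡ count p
∣tabulate∣ {zero}  p = refl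
∣tabulate∣ {suc _} p with p zero
... | true  = cong suc (∣tabulate∣ (p ∘ suc))
... | false = ∣tabulate∣ (p ∘ suc)

length-filter-tabulate : ∀ {a} {A : Set a} (p : A → Bool) (f : Fin n → A) →
  length (filter (T? ∘ p) (Vec.toList (Vec.tabulate f))) ≡ count (p ∘ f)
length-filter-tabulate {n = zero}  p f = refl
length-filter-tabulate {n = suc _} p f with p (f zero)
... | true  = cong suc (length-filter-tabulate p (f ∘ suc))
... | false = length-filter-tabulate p (f ∘ suc)

degree≡count : (G : Graph n) → ∀ v → degree G v ≡ count (adj G v)
degree≡count G v = length-filter-tabulate (adj G v) id

-- Independence number and logarithm.

Independent : Graph n → (Fin n → Bool) → Set
Independent G X = ∀ u v → T (X u) → T (X v) → ¬ Adj G u v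

count-independent : (G : Graph n) {α : ℕ} → IsIndependenceNumber G α → (p : Fin n → Bool) →
  Independent G p → count p ≤ α
count-independent G (_ , max) p ind = subst (_≤ _) (∣tabulate∣ p) (max (Vec.tabulate p)
  λ u v u∈ v∈ → ind u v (holds u∈) (holds v∈))
  where
  holds : ∀ {u} → u ∈ Vec.tabulate p → T (p u)
  holds {u} u∈ = subst T (trans (≡-sym ([]=⇒lookup u∈)) (lookup∘tabulate p u)) _

<2^[1+⌊log₂⌋] : ∀ n → n < 2 ^ suc ⌊log₂ n ⌋
<2^[1+⌊log₂⌋] n = ≰⇒> λ 2^≤n → 1+n≰n
  (subst (_≤ ⌊log₂ n ⌋) (⌊log₂[2^n]⌋≡n (suc ⌊log₂ n ⌋)) (⌊log₂⌋-mono-≤ 2^≤n))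

-- Two-colouring a hypergraph without monochromatic edges.

-- The number of subsets of Fin n with a prescribed trace on E.
free : (Fin n → Bool) → ℕ
free {zero}  E = 1
free {suc _} E = (if E zero then 1 else 2) * free (E ∘ suc)

-- Each index doubles exactly one of the two factors. So `free E` over 2 ^ n is the probability that
-- a random set has a given trace on `E`.
free*2^count : (E : Fin n → Bool) → free E * 2 ^ count E ≡ 2 ^ n
free*2^count {zero}  E = refl
free*2^count {suc n} E with E zero
... | true  = trans (solve 2 (λ a b → (con 1 :* a) :* (con 2 :* b) := con 2 :* (a :* b)) refl
                      (free (E ∘ suc)) (2 ^ count (E ∘ suc)))
                    (cong (2 *_) (free*2^count (E ∘ suc)))
  where open +-*-Solver
... | false = trans (*-assoc 2 (free (E ∘ suc)) _) (cong (2 *_) (free*2^count (E ∘ suc)))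

-- The weight of "the edge is all of `colour`" after one vertex is decided: it drops to 0 if the
-- edge contains the vertex and the choice differs. The change in probability is carried by `free`.
survive : (inEdge chosen colour : Bool) → ℕ → ℕ
survive false _     _     x = x
survive true  true  true  x = x
survive true  false false x = x
survive true  true  false _ = 0
survive true  false true  _ = 0

-- If the vertex is on the edge, each choice keeps exactly one of the two events; if not, both
-- choices keep both, and this is the factor 2 in `free`. So the potential is the sum of those of
-- the two choices.
survive-average : ∀ h x y φ →
  (x + y) * ((if h then 1 else 2) * φ) ≡
    (survive h true true x + survive h true false y) * φ +
    (survive h false true x + survive h false false y) * φ
survive-average true  = solve 3 (λ x y φ → (x :+ y) :* (con 1 :* φ) :=
    (x :+ con 0) :* φ :+ (con 0 :+ y) :* φ) refl
  where open +-*-Solver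
survive-average false = solve 3 (λ x y φ → (x :+ y) :* (con 2 :* φ) :=
    (x :+ y) :* φ :+ (x :+ y) :* φ) refl
  where open +-*-Solver

survive-or-split : ∀ h c b {x} → x ≢ 0 → survive h c b x ≢ 0 ⊎ (T h × c ≢ b)
survive-or-split false _     _     x≢0 = inj₁ x≢0
survive-or-split true  true  true  x≢0 = inj₁ x≢0
survive-or-split true  false false x≢0 = inj₁ x≢0
survive-or-split true  true  false _   = inj₂ (_ , λ ())
survive-or-split true  false true  _   = inj₂ (_ , λ ())

<2*⇒<⊎< : ∀ a b c → a + b < 2 * c → a < c ⊎ b < c
<2*⇒<⊎< a b c a+b<2c with a <? c
... | yes a<c = inj₁ a<c
... | no  a≮c = inj₂ (≰⇒> λ c≤b → <⇒≱ a+b<2c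
        (subst (_≤ a + b) (cong (c +_) (≡-sym (+-identityʳ c))) (+-mono-≤ (≮⇒≥ a≮c) c≤b)))

-- Method of conditional expectations; w b e is the weight of the event that the edge e
-- becomes monochromatic in colour b, and it drops to 0 once that is excluded.
split-edges : ∀ {n m} (E : Fin m → Fin n → Bool) (w : Bool → Fin m → ℕ) →
  sum (λ e → (w true e + w false e) * free (E e)) < 2 ^ n →
  Σ (Fin n → Bool) λ Y → ∀ e b → w b e ≢ 0 → ∃ λ i → T (E e i) × Y i ≢ b
-- No vertices remain, so `free` is 1 and the potential is the sum of the weights; being below 1, it
-- leaves no nonzero weight.
split-edges {zero} E w Φ<1 = (λ ()) , λ e b w≢0 → ⊥-elim (w≢0 (vanishes b e))
  where
  both : ∀ e → w true e + w false e ≡ 0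
  both e = n≤0⇒n≡0 (≤-trans (≤-reflexive (≡-sym (*-identityʳ _)))
    (≤-trans (term≤sum _ e) (≤-pred Φ<1)))
  vanishes : ∀ b e → w b e ≡ 0
  vanishes true  e = m+n≡0⇒m≡0 _ (both e)
  vanishes false e = m+n≡0⇒n≡0 (w true e) (both e)
split-edges {suc n} {m} E w Φ<2^ = case-Φ (<2*⇒<⊎< (Φ′ true) (Φ′ false) (2 ^ n)
  (subst (_< 2 * 2 ^ n) average Φ<2^))
  where
  w′ : Bool → Bool → Fin m → ℕ
  w′ c b e = survive (E e zero) c b (w b e)
  φ : Bool → Fin m → ℕ
  φ c e = (w′ c true e + w′ c false e) * free (E e ∘ suc)
  Φ′ : Bool → ℕ
  Φ′ c = sum (φ c)
  average : sum (λ e → (w true e + w false e) * free (E e)) ≡ Φ′ true + Φ′ false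
  average = trans (sum-cong-≗ λ e → survive-average (E e zero) _ _ _)
                  (∑-distrib-+ (φ true) (φ false))
  extend : ∀ c → Φ′ c < 2 ^ n →
    Σ (Fin (suc n) → Bool) λ Y → ∀ e b → w b e ≢ 0 → ∃ λ i → T (E e i) × Y i ≢ b
  extend c Φ<  with split-edges (λ e → E e ∘ suc) (w′ c) Φ<
  ... | Y′ , splits′ = Y , splits
    where
    Y : Fin (suc n) → Bool
    Y zero    = c
    Y (suc i) = Y′ i
    splits : ∀ e b → w b e ≢ 0 → ∃ λ i → T (E e i) × Y i ≢ b
    splits e b w≢0 with survive-or-split (E e zero) c b w≢0
    ... | inj₂ (0∈e , c≢b) = zero , 0∈e , c≢b
    ... | inj₁ w′≢0 with splits′ e b w′≢0
    ...   | i , i∈e , Yi≢b = suc i , i∈e , Yi≢b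
  case-Φ : Φ′ true < 2 ^ n ⊎ Φ′ false < 2 ^ n → _
  case-Φ (inj₁ Φ<) = extend true Φ<
  case-Φ (inj₂ Φ<) = extend false Φ<

-- Maxima, strict sums and predicates with at most one member.

argmax : (f : Fin n → ℕ) → (∀ j → f j ≡ 0) ⊎ (∃ λ i → 0 < f i × ∀ j → f j ≤ f i)
argmax {zero}  f = inj₁ λ ()
argmax {suc _} f with argmax (f ∘ suc) | f zero in f₀
... | inj₁ zeros           | zero  = inj₁ λ { zero → f₀ ; (suc j) → zeros j }
... | inj₁ zeros           | suc _ = inj₂ (zero , subst (0 <_) (≡-sym f₀) (s≤s z≤n) , λ
        { zero → ≤-refl ; (suc j) → ≤-trans (≤-reflexive (zeros j)) z≤n })
... | inj₂ (i , fi>0 , mx) | _     with f zero ≤? f (suc i)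
...   | yes f₀≤ = inj₂ (suc i , fi>0 , λ { zero → f₀≤ ; (suc j) → mx j })
...   | no  f₀≰ = inj₂ (zero , ≤-trans fi>0 (≰⇒≥ f₀≰) , λ
        { zero → ≤-refl ; (suc j) → ≤-trans (mx j) (≰⇒≥ f₀≰) })

sum-mono-< : {f g : Fin n → ℕ} → (∀ i → f i ≤ g i) → ∀ x → f x < g x → sum f < sum g
sum-mono-< f≤g zero    fx<gx = +-mono-<-≤ fx<gx (sum-mono (f≤g ∘ suc))
sum-mono-< f≤g (suc x) fx<gx = +-mono-≤-< (f≤g zero) (sum-mono-< (f≤g ∘ suc) x fx<gx)

toList-tabulate : ∀ {a} {A : Set a} (f : Fin n → A) →
  Vec.toList (Vec.tabulate f) ≡ List.tabulate f
toList-tabulate {zero}  f = refl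
toList-tabulate {suc _} f = cong (f zero ∷_) (toList-tabulate (f ∘ suc))

count-positive : (p : Fin n → Bool) → ∀ {u} → T (p u) → 1 ≤ count p
count-positive p {u} pu = ≤-trans (lemma (p u) pu) (term≤sum (⟦_⟧ ∘ p) u)
  where
  lemma : ∀ b → T b → 1 ≤ ⟦ b ⟧
  lemma true _ = ≤-refl

count<2⇒unique : (p : Fin n → Bool) → count p < 2 → ∀ u v → T (p u) → T (p v) → u ≡ v
count<2⇒unique p p<2 zero    zero    pu pv = refl
count<2⇒unique p p<2 zero    (suc v) pu pv with p zero
... | true = ⊥-elim (<⇒≱ (≤-pred p<2) (count-positive (p ∘ suc) pv))
count<2⇒unique p p<2 (suc u) zero    pu pv with p zero
... | true = ⊥-elim (<⇒≱ (≤-pred p<2) (count-positive (p ∘ suc) pu))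
count<2⇒unique p p<2 (suc u) (suc v) pu pv =
  cong suc (count<2⇒unique (p ∘ suc) (≤-<-trans (m≤n+m _ ⟦ p zero ⟧) p<2) u v pu pv)

-- Greedy independent sets meeting many neighbourhoods.

module _ (G : Graph n) where

  symmetric : ∀ {u v} → Adj G u v → Adj G v u
  symmetric {u} {v} = subst T (sym G u v)

  irreflexive : ∀ {v} → ¬ Adj G v v
  irreflexive {v} = subst T (irrefl G v)

  common : (Fin n → Bool) → Fin n → ℕ
  common A y = count λ v → adj G y v ∧ A v

  -- `P` holds the vertices still allowed in `X`, and `A` those whose neighbourhoods `X` should
  -- meet. The left side of `bound` counts pairs of an allowed vertex and an unhit neighbour in `A`.
  record Greedy (r : ℕ) (P A : Fin n → Bool) : Set where
    field
      X           : Fin n → Bool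
      hit         : Fin n → Bool
      X⊆P         : ∀ u → T (X u) → T (P u)
      independent : Independent G X
      sound       : ∀ v → T (hit v) → ∃ λ u → Adj G v u × T (X u)
      bound       : sum (λ y → ⟦ P y ⟧ * common (A ∖ hit) y) ≤ r * count (A ∩ hit)

  open Greedy

  common-mono : ∀ {A B} → (∀ v → ⟦ A v ⟧ ≤ ⟦ B v ⟧) → ∀ y → common A y ≤ common B y
  common-mono {A} {B} A≤B y = sum-mono pointwise
    where
    pointwise : ∀ v → ⟦ adj G y v ∧ A v ⟧ ≤ ⟦ adj G y v ∧ B v ⟧
    pointwise v with adj G y v
    ... | true  = A≤B v
    ... | false = z≤n

  -- Pick the available x with the most neighbours in A, say d of them: these get hit, and each of
  -- the r neighbours of x that stop being available is adjacent to at most d vertices of A.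
  greedy : ∀ {r} → Regular G r → ∀ k P A → count P < k → Greedy r P A
  greedy {r} reg (suc k) P A (s≤s ∣P∣≤k)
    with argmax (λ y → ⟦ P y ⟧ * common A y)
  -- No allowed vertex has a neighbour in `A`, so the left side of `bound` is 0 already for the
  -- empty set.
  ... | inj₁ zeros = record
    { X = λ _ → false ; hit = λ _ → false ; X⊆P = λ _ () ; independent = λ _ _ () ; sound = λ _ ()
    ; bound = ≤-trans (sum-mono λ y → *-monoʳ-≤ ⟦ P y ⟧ (common-mono (∖-≤ A _) y))
        (≤-trans (≤-reflexive (sum-vanishes zeros)) z≤n) }
  ... | inj₂ (x , fx>0 , max) = record
    { X = X′
    ; hit = hit′
    ; X⊆P = X⊆P′
    ; independent = independent′
    ; sound = sound′
    ; bound = bound′ }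
    where
    P′ A′ : Fin n → Bool
    -- Discarding the neighbours of `x` keeps `X` independent; discarding `x` itself makes `count P`
    -- drop, so the fuel `k` suffices.
    P′ y = P y ∧ not (does (y ≟ x) ∨ adj G x y)
    A′ v = A v ∧ not (adj G x v)
    Px : P x ≡ true
    Px with P x
    ... | true = refl
    ... | false = ⊥-elim (n≮0 fx>0)
    P′≤P : ∀ y → ⟦ P′ y ⟧ ≤ ⟦ P y ⟧
    P′≤P y with P y | does (y ≟ x) ∨ adj G x y
    ... | true | true = z≤n
    ... | true | false = ≤-refl
    ... | false | _ = z≤n
    P′x<Px : ⟦ P′ x ⟧ < ⟦ P x ⟧
    P′x<Px rewrite Px | dec-true (x ≟ x) refl = ≤-refl
    G′ : Greedy r P′ A′
    G′ = greedy reg k P′ A′ (≤-trans (sum-mono-< P′≤P x P′x<Px) ∣P∣≤k)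
    d : ℕ
    d = common A x

    X′ hit′ : Fin n → Bool
    X′ u = does (u ≟ x) ∨ X G′ u
    hit′ v = adj G x v ∨ hit G′ v

    X⊆P′ : ∀ u → T (X′ u) → T (P u)
    X⊆P′ u u∈ with u ≟ x
    ... | yes refl = subst T (≡-sym Px) _
    ... | no _ with P u | X⊆P G′ u u∈
    ...   | true | _ = _

    outside : ∀ u → T (X G′ u) → ¬ Adj G x u
    outside u u∈ x~u with P u | does (u ≟ x) | adj G x u | X⊆P G′ u u∈
    ... | true | false | true | ()
    ... | true | true  | true | ()

    independent′ : Independent G X′
    independent′ u v u∈ v∈ u~v with u ≟ x | v ≟ x
    ... | yes refl | yes refl = irreflexive u~v
    ... | yes refl | no _     = outside v v∈ u~v
    ... | no _     | yes refl = outside u u∈ (symmetric u~v)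
    ... | no _     | no _     = independent G′ u v u∈ v∈ u~v

    sound′ : ∀ v → T (hit′ v) → ∃ λ u → Adj G v u × T (X′ u)
    sound′ v v∈ with adj G x v in x~v
    ... | true = x , symmetric (subst T (≡-sym x~v) _) ,
                 subst (λ b → T (b ∨ X G′ x)) (≡-sym (dec-true (x ≟ x) refl)) _
    ... | false with sound G′ v v∈
    ...   | u , v~u , u∈ with u ≟ x in u≟x
    ...     | yes _ = u , v~u , subst (λ b → T (does b ∨ X G′ u)) (≡-sym u≟x) _
    ...     | no  _ = u , v~u , subst (λ b → T (does b ∨ X G′ u)) (≡-sym u≟x) u∈

    unhit-≤ : ∀ v → ⟦ (A ∖ hit′) v ⟧ ≤ ⟦ (A′ ∖ hit G′) v ⟧
    unhit-≤ v with A v | adj G x v | hit G′ v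
    ... | true  | true  | _     = z≤n
    ... | true  | false | _     = ≤-refl
    ... | false | _     | _     = z≤n

    none-at-x : common (A ∖ hit′) x ≡ 0
    none-at-x = sum-vanishes pointwise
      where
      pointwise : ∀ v → ⟦ adj G x v ∧ (A ∖ hit′) v ⟧ ≡ 0
      pointwise v with adj G x v | A v
      ... | true  | true  = refl
      ... | true  | false = refl
      ... | false | _     = refl

    common≤d : ∀ y → P y ≡ true → common A y ≤ d
    common≤d y Py = subst₂ _≤_ (simplify Py) (simplify Px) (max y)
      where
      simplify : ∀ {b k} → b ≡ true → ⟦ b ⟧ * k ≡ k
      simplify refl = *-identityˡ _

    -- For `y = x` nothing remains, since all its neighbours are now hit; a neighbour of `x` is
    -- charged at most `d` by maximality; any other allowed `y` stays allowed.
    charge : ∀ y → ⟦ P y ⟧ * common (A ∖ hit′) y ≤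
                   ⟦ P′ y ⟧ * common (A′ ∖ hit G′) y + ⟦ adj G x y ⟧ * d
    charge y with P y in Py
    ... | false = z≤n
    ... | true with y ≟ x
    ...   | yes refl = ≤-trans (≤-reflexive (trans (*-identityˡ _) none-at-x)) z≤n
    ...   | no _ with adj G x y
    ...     | true  = *-monoʳ-≤ 1 (≤-trans (common-mono (∖-≤ A hit′) y) (common≤d y Py))
    ...     | false = ≤-trans (*-monoʳ-≤ 1 (common-mono unhit-≤ y)) (m≤m+n _ 0)

    newly-hit : ∀ v → ⟦ (A′ ∩ hit G′) v ⟧ + ⟦ adj G x v ∧ A v ⟧ ≡ ⟦ (A ∩ hit′) v ⟧
    newly-hit v with A v | adj G x v | hit G′ v
    ... | true  | true  | _     = refl
    ... | true  | false | true  = refl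
    ... | true  | false | false = refl
    ... | false | true  | _     = refl
    ... | false | false | _     = refl

    bound′ : sum (λ y → ⟦ P y ⟧ * common (A ∖ hit′) y) ≤ r * count (A ∩ hit′)
    bound′ = begin
      sum (λ y → ⟦ P y ⟧ * common (A ∖ hit′) y)
        ≤⟨ sum-mono charge ⟩
      sum (λ y → ⟦ P′ y ⟧ * common (A′ ∖ hit G′) y + ⟦ adj G x y ⟧ * d)
        ≡⟨ ∑-distrib-+ {n} (λ y → ⟦ P′ y ⟧ * common (A′ ∖ hit G′) y) _ ⟩
      sum (λ y → ⟦ P′ y ⟧ * common (A′ ∖ hit G′) y) + sum (λ y → ⟦ adj G x y ⟧ * d)
        ≡⟨ cong (sum (λ y → ⟦ P′ y ⟧ * common (A′ ∖ hit G′) y) +_)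
             (trans (≡-sym (*-distribʳ-sum {n} d (⟦_⟧ ∘ adj G x)))
                    (cong (_* d) (trans (≡-sym (degree≡count G x)) (reg x)))) ⟩
      sum (λ y → ⟦ P′ y ⟧ * common (A′ ∖ hit G′) y) + r * d
        ≤⟨ +-monoˡ-≤ (r * d) (bound G′) ⟩
      r * count (A′ ∩ hit G′) + r * d
        ≡⟨ ≡-sym (*-distribˡ-+ r _ d) ⟩
      r * (count (A′ ∩ hit G′) + d)
        ≡⟨ cong (r *_) (trans (≡-sym (∑-distrib-+ {n} (⟦_⟧ ∘ (A′ ∩ hit G′)) _))
                           (sum-cong-≗ newly-hit)) ⟩
      r * count (A ∩ hit′) ∎
      where open ≤-Reasoning

  -- With every vertex allowed, double counting turns the left side of `bound` into `r` times the
  -- number of unhit vertices of `B`; cancelling the positive `r` leaves at most as many unhit as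
  -- hit.
  halving : ∀ {r} → Regular G r → 1 ≤ r → ∀ B →
    Σ (Fin n → Bool) λ X → Σ (Fin n → Bool) λ hit → Independent G X ×
    (∀ v → T (hit v) → ∃ λ u → Adj G v u × T (X u)) × 2 * count (B ∖ hit) ≤ count B
  halving {suc r} reg _ B = X g , hit g , independent g , sound g , (begin
    2 * count (B ∖ hit g)                 ≡⟨ cong (count (B ∖ hit g) +_) (+-identityʳ _) ⟩
    count (B ∖ hit g) + count (B ∖ hit g) ≤⟨ +-monoʳ-≤ (count (B ∖ hit g)) unhit≤hit ⟩
    count (B ∖ hit g) + count (B ∩ hit g) ≡⟨ ≡-sym (∑-distrib-+ {n} (⟦_⟧ ∘ (B ∖ hit g)) _) ⟩
    sum (λ v → ⟦ (B ∖ hit g) v ⟧ + ⟦ (B ∩ hit g) v ⟧) ≡⟨ sum-cong-≗ partition ⟩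
    count B                               ∎)
    where
    open ≤-Reasoning
    g : Greedy (suc r) (λ _ → true) B
    g = greedy reg _ _ B ≤-refl
    partition : ∀ v → ⟦ (B ∖ hit g) v ⟧ + ⟦ (B ∩ hit g) v ⟧ ≡ ⟦ B v ⟧
    partition v with B v | hit g v
    ... | true  | true  = refl
    ... | true  | false = refl
    ... | false | _     = refl
    factor : ∀ a b → ⟦ a ∧ b ⟧ ≡ ⟦ a ⟧ * ⟦ b ⟧
    factor true  b = ≡-sym (*-identityˡ ⟦ b ⟧)
    factor false b = refl
    double-count : ∀ U → sum (λ y → 1 * common U y) ≡ suc r * count U
    double-count U = begin-equality
      sum (λ y → 1 * common U y)
        ≡⟨ sum-cong-≗ (λ y → *-identityˡ (common U y)) ⟩
      sum (λ y → sum λ v → ⟦ adj G y v ∧ U v ⟧)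
        ≡⟨ ∑-comm (λ y v → ⟦ adj G y v ∧ U v ⟧) ⟩
      sum (λ v → sum λ y → ⟦ adj G y v ∧ U v ⟧)
        ≡⟨ sum-cong-≗ (λ v → trans
             (sum-cong-≗ λ y → trans (factor (adj G y v) (U v))
               (cong (λ b → ⟦ b ⟧ * ⟦ U v ⟧) (sym G y v)))
             (trans (≡-sym (*-distribʳ-sum {n} ⟦ U v ⟧ (⟦_⟧ ∘ adj G v)))
                    (cong (_* ⟦ U v ⟧) (trans (≡-sym (degree≡count G v)) (reg v))))) ⟩
      sum (λ v → suc r * ⟦ U v ⟧)
        ≡⟨ ≡-sym (*-distribˡ-sum {n} (suc r) (⟦_⟧ ∘ U)) ⟩
      suc r * count U ∎
    unhit≤hit : count (B ∖ hit g) ≤ count (B ∩ hit g)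
    unhit≤hit = *-cancelˡ-≤ (suc r) 
      (subst (_≤ suc r * count (B ∩ hit g)) (double-count (B ∖ hit g)) (bound g))

  -- Neighbourhoods as lists.

  neighbours-allFin : ∀ v → neighbours G v ≡ filter (λ u → T? (adj G v u)) (List.allFin n)
  neighbours-allFin v = cong (filter (λ u → T? (adj G v u))) (toList-tabulate id)

  Adj⇒∈ : ∀ {v u} → Adj G v u → u List.∈ neighbours G v
  Adj⇒∈ {v} {u} v~u = subst (u List.∈_) (≡-sym (neighbours-allFin v))
    (∈-filter⁺ (λ u → T? (adj G v u)) (∈-allFin u) v~u)

  ∈⇒Adj : ∀ {v u} → u List.∈ neighbours G v → Adj G v u
  ∈⇒Adj {v} {u} u∈ = proj₂ (∈-filter⁻ (λ u → T? (adj G v u)) {xs = List.allFin n}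
    (subst (u List.∈_) (neighbours-allFin v) u∈))

  two-neighbours : ∀ v → 2 ≤ degree G v → ∃ λ a → ∃ λ b → Adj G v a × Adj G v b × a ≢ b
  two-neighbours v 2≤d = go (neighbours G v) 2≤d (λ u → ∈⇒Adj)
    (subst Unique (≡-sym (neighbours-allFin v))
      (Unique.filter⁺ (λ u → T? (adj G v u)) (Unique.allFin⁺ n)))
    where
    go : ∀ us → 2 ≤ length us → (∀ u → u List.∈ us → Adj G v u) → Unique us →
      ∃ λ a → ∃ λ b → Adj G v a × Adj G v b × a ≢ b
    go (a ∷ b ∷ _) _ ⊆N ((a≢b ∷ _) ∷ _) =
      a , b , ⊆N a (here refl) , ⊆N b (there (here refl)) , a≢b
    go (_ ∷ []) (s≤s ())

  -- Partial recolourings that meet prescribed neighbourhoods.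

  PartialProper : ∀ {k} → (Fin n → Maybe (Fin k)) → Set
  PartialProper g = ∀ u v i → Adj G u v → g u ≡ just i → g v ≢ just i

  -- Colour 0 is used at most once, so it cannot fill a neighbourhood of size ≥ 2
  -- and need not be split later; this saves the last colour of the bound.
  record Hitting (ℓ : ℕ) (B : Fin n → Bool) : Set where
    field
      g       : Fin n → Maybe (Fin (suc ℓ))
      proper  : PartialProper g
      hits    : ∀ v → T (B v) → ∃ λ u → Adj G v u × g u ≢ nothing
      at-most-one : ∀ u w → g u ≡ just zero → g w ≡ just zero → u ≡ w

  -- Each halving spends one colour and lowers the exponent by one, so after `ℓ` of them at most one
  -- vertex of `B` remains, and giving one of its neighbours colour 0 suffices.
  hitting : ∀ {r} → Regular G r → 2 ≤ r → ∀ ℓ B → count B < 2 ^ suc ℓ → Hitting ℓ B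
  hitting reg 2≤r zero B B<2 with any? (T? ∘ B)
  ... | no none = record
    { g = λ _ → nothing ; proper = λ _ _ _ _ () ; hits = λ v v∈B → ⊥-elim (none (v , v∈B))
    ; at-most-one = λ _ _ () }
  ... | yes (v₀ , v₀∈B) with two-neighbours v₀ (subst (2 ≤_) (≡-sym (reg v₀)) 2≤r)
  ...   | x , _ , v₀~x , _ = record
    { g = g ; proper = proper
    ; hits = λ v v∈B → x , subst (λ v → Adj G v x) (count<2⇒unique B B<2 v₀ v v₀∈B v∈B) v₀~x , gx
    ; at-most-one = λ u w gu gw → trans (class gu) (≡-sym (class gw)) }
    where
    g : Fin n → Maybe (Fin 1)
    g u = if does (u ≟ x) then just zero else nothing
    gx : g x ≢ nothing
    gx rewrite dec-true (x ≟ x) refl = λ ()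
    class : ∀ {u i} → g u ≡ just i → u ≡ x
    class {u} gu with u ≟ x
    ... | yes u≡x = u≡x
    proper : PartialProper g
    proper u v i u~v gu gv = irreflexive (subst₂ (Adj G) (class gu) (class gv) u~v)
  hitting reg 2≤r (suc ℓ) B B<2^ with halving reg (≤-trans (s≤s z≤n) 2≤r) B
  ... | X , hit , ind , sound , half = record
    { g = g′ ; proper = proper′ ; hits = hits′ ; at-most-one = at-most-one′ }
    where
    H : Hitting ℓ (B ∖ hit)
    H = hitting reg 2≤r ℓ (B ∖ hit) (*-cancelˡ-< 2 _ _ (≤-<-trans half B<2^))
    open Hitting H
    g′ : Fin n → Maybe (Fin (suc (suc ℓ)))
    -- The new class takes the top colour and may overwrite older ones, which leaves earlier hits
    -- intact; `inject₁` keeps colour 0 in place, so it is still used at most once.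
    g′ u = if X u then just (fromℕ (suc ℓ)) else Maybe.map inject₁ (g u)
    cases : ∀ u {i} → g′ u ≡ just i →
      (T (X u) × fromℕ (suc ℓ) ≡ i) ⊎ (∃ λ j → g u ≡ just j × inject₁ j ≡ i)
    cases u g′u with X u | g u
    cases u refl | true  | _      = inj₁ (_ , refl)
    cases u refl | false | just j = inj₂ (j , refl , refl)
    proper′ : PartialProper g′
    proper′ u v i u~v g′u g′v with cases u g′u | cases v g′v
    ... | inj₁ (u∈X , _)     | inj₁ (v∈X , _)        = ind u v u∈X v∈X u~v
    ... | inj₁ (_ , refl)    | inj₂ (_ , _ , eq)     = fromℕ≢inject₁ (≡-sym eq)
    ... | inj₂ (_ , _ , eq)  | inj₁ (_ , refl)       = fromℕ≢inject₁ (≡-sym eq)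
    ... | inj₂ (j , gu , eq) | inj₂ (j′ , gv , refl) =
      proper u v j u~v gu (trans gv (cong just (≡-sym (inject₁-injective eq))))
    X⇒ : ∀ u → T (X u) → g′ u ≢ nothing
    X⇒ u u∈X with X u
    ... | true = λ ()
    g⇒ : ∀ u → g u ≢ nothing → g′ u ≢ nothing
    g⇒ u gu with X u | g u
    ... | true  | _       = λ ()
    ... | false | just _  = λ ()
    ... | false | nothing = λ _ → gu refl
    hits′ : ∀ v → T (B v) → ∃ λ u → Adj G v u × g′ u ≢ nothing
    hits′ v v∈B with B v | hit v | sound v | hits v
    ... | true | true  | s | _ with s _
    ...   | u , v~u , u∈X = u , v~u , X⇒ u u∈X
    hits′ v v∈B | true | false | _ | h with h _
    ...   | u , v~u , gu = u , v~u , g⇒ u gu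
    at-most-one′ : ∀ u w → g′ u ≡ just zero → g′ w ≡ just zero → u ≡ w
    at-most-one′ u w g′u g′w with cases u g′u | cases w g′w
    ... | inj₂ (zero , gu , _) | inj₂ (zero , gw , _) = at-most-one u w gu gw

  -- Bad vertices and the splitting of their neighbourhoods.

  Dichromatic : ∀ {k} → (Fin n → Fin k) → Fin n → Set
  Dichromatic c v = ∃ λ u → ∃ λ w → Adj G v u × Adj G v w × c u ≢ c w

  dichromatic? : ∀ {k} (c : Fin n → Fin k) v → Dec (Dichromatic c v)
  dichromatic? c v = any? λ u → any? λ w →
    T? (adj G v u) ×-dec T? (adj G v w) ×-dec ¬? (c u ≟ c w)

  Monochromatic : ∀ {k} → (Fin n → Fin k) → Fin n → Set
  Monochromatic c v = ∀ u w → Adj G v u → Adj G v w → c u ≡ c w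

  ¬dichromatic⇒mono : ∀ {k} (c : Fin n → Fin k) v → ¬ Dichromatic c v → Monochromatic c v
  ¬dichromatic⇒mono c v ¬di u w v~u v~w = decidable-stable (c u ≟ c w)
    λ cu≢cw → ¬di (u , w , v~u , v~w , cu≢cw)

  bad : ∀ {k} → (Fin n → Fin k) → Fin n → Bool
  bad c v = not (does (dichromatic? c v))

  bad⇒mono : ∀ {k} (c : Fin n → Fin k) v → T (bad c v) → Monochromatic c v
  bad⇒mono c v v∈ with dichromatic? c v
  ... | no ¬di = ¬dichromatic⇒mono c v ¬di

  mono⇒bad : ∀ {k} (c : Fin n → Fin k) v → Monochromatic c v → T (bad c v)
  mono⇒bad c v mono with dichromatic? c v
  ... | yes (u , w , v~u , v~w , cu≢cw) = cu≢cw (mono u w v~u v~w)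
  ... | no _ = _

  -- If u and v are adjacent and bad, then N(u) has colour c v and N(v) has colour c u; so the bad
  -- vertices whose neighbourhood has a larger colour than their own are independent, and so are
  -- the others.
  few-bad : ∀ {k α} (c : Fin n → Fin k) → IsProperColoring G k c → IsIndependenceNumber G α →
    count (bad c) ≤ α + α
  few-bad {α = α} c proper isα = begin
    count (bad c) ≡⟨ sum-cong-≗ partition ⟩
    sum (λ v → ⟦ below v ⟧ + ⟦ above v ⟧) ≡⟨ ∑-distrib-+ {n} (⟦_⟧ ∘ below) (⟦_⟧ ∘ above) ⟩
    count below + count above ≤⟨ +-mono-≤ (count-independent G isα below below-independent)
                                          (count-independent G isα above above-independent) ⟩
    α + α ∎
    where
    open ≤-Reasoning
    Up : Fin n → Set
    Up v = ∃ λ u → Adj G v u × c v Fin.< c u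
    up? : ∀ v → Dec (Up v)
    up? v = any? λ u → T? (adj G v u) ×-dec (c v Fin.<? c u)
    below above : Fin n → Bool
    below v = bad c v ∧ does (up? v)
    above v = bad c v ∧ not (does (up? v))
    partition : ∀ v → ⟦ bad c v ⟧ ≡ ⟦ below v ⟧ + ⟦ above v ⟧
    partition v with bad c v | does (up? v)
    ... | true  | true  = refl
    ... | true  | false = refl
    ... | false | _     = refl
    -- The neighbourhood has a single colour, so one larger neighbour makes all of them larger.
    below⇒ : ∀ v → T (below v) → ∀ u → Adj G v u → c v Fin.< c u
    below⇒ v v∈ u v~u with bad c v | bad⇒mono c v | up? v
    ... | true | mono | yes (w , v~w , cv<cw) = subst (c v Fin.<_) (mono _ w u v~w v~u) cv<cw
    above⇒ : ∀ v → T (above v) → ∀ u → Adj G v u → ¬ c v Fin.< c u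
    above⇒ v v∈ u v~u cv<cu with bad c v | up? v
    ... | true | no ¬up = ¬up (u , v~u , cv<cu)
    below-independent : Independent G below
    below-independent u v u∈ v∈ u~v =
      <-asym (below⇒ u u∈ v u~v) (below⇒ v v∈ u (symmetric u~v))
    above-independent : Independent G above
    above-independent u v u∈ v∈ u~v with Fin.<-cmp (c u) (c v)
    ... | tri< cu<cv _ _ = above⇒ u u∈ v u~v cu<cv
    ... | tri≈ _ cu≡cv _ = proper u v u~v cu≡cv
    ... | tri> _ _ cv<cu = above⇒ v v∈ u (symmetric u~v) cv<cu

  -- Union bound: a random set is constant on a given `r`-set with probability 2 ^ (1 - r), and `B`
  -- supplies fewer than 2 ^ (r - 1) such sets. Both weights start at 1 on `B` and at 0 elsewhere.
  split-neighbourhoods : ∀ {r} → Regular G r → ∀ B → count B + count B < 2 ^ r →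
    Σ (Fin n → Bool) λ Y → ∀ v → T (B v) → ∀ b → ∃ λ u → Adj G v u × Y u ≢ b
  split-neighbourhoods {r} reg B 2B<2^r
    with split-edges (adj G) (λ _ v → ⟦ B v ⟧) (*-cancelʳ-< (2 ^ r) _ _ Φ<)
    where
    open ≤-Reasoning
    pointwise : ∀ v → (⟦ B v ⟧ + ⟦ B v ⟧) * free (adj G v) * 2 ^ r ≡ (⟦ B v ⟧ + ⟦ B v ⟧) * 2 ^ n
    pointwise v = trans (*-assoc (⟦ B v ⟧ + ⟦ B v ⟧) (free (adj G v)) (2 ^ r))
      (cong ((⟦ B v ⟧ + ⟦ B v ⟧) *_)
        (trans (cong (λ d → free (adj G v) * 2 ^ d) (trans (≡-sym (reg v)) (degree≡count G v)))
          (free*2^count (adj G v))))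
    Φ< : sum (λ v → (⟦ B v ⟧ + ⟦ B v ⟧) * free (adj G v)) * 2 ^ r < 2 ^ n * 2 ^ r
    Φ< = begin-strict
      sum (λ v → (⟦ B v ⟧ + ⟦ B v ⟧) * free (adj G v)) * 2 ^ r
        ≡⟨ *-distribʳ-sum {n} (2 ^ r) (λ v → (⟦ B v ⟧ + ⟦ B v ⟧) * free (adj G v)) ⟩
      sum (λ v → (⟦ B v ⟧ + ⟦ B v ⟧) * free (adj G v) * 2 ^ r)
        ≡⟨ sum-cong-≗ pointwise ⟩
      sum (λ v → (⟦ B v ⟧ + ⟦ B v ⟧) * 2 ^ n)
        ≡⟨ ≡-sym (*-distribʳ-sum {n} (2 ^ n) (λ v → ⟦ B v ⟧ + ⟦ B v ⟧)) ⟩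
      sum (λ v → ⟦ B v ⟧ + ⟦ B v ⟧) * 2 ^ n
        ≡⟨ cong (_* 2 ^ n) (∑-distrib-+ {n} (⟦_⟧ ∘ B) (⟦_⟧ ∘ B)) ⟩
      (count B + count B) * 2 ^ n
        <⟨ *-monoˡ-< (2 ^ n) {{m^n≢0 2 n}} 2B<2^r ⟩
      2 ^ r * 2 ^ n
        ≡⟨ *-comm (2 ^ r) (2 ^ n) ⟩
      2 ^ n * 2 ^ r ∎
  ... | Y , splits = Y , λ v v∈B b → splits v b (nonzero v∈B)
    where
    nonzero : ∀ {b} → T b → ⟦ b ⟧ ≢ 0
    nonzero {true} _ ()

  -- The two rounds of recolouring.

  override : ∀ {k ℓ} → (Fin n → Fin k) → (Fin n → Maybe (Fin ℓ)) → Fin n → Fin (k + ℓ)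
  override {k} {ℓ} c g u = Maybe.maybe (k ↑ʳ_) (c u ↑ˡ ℓ) (g u)

  -- Old and new colours occupy disjoint blocks, so two vertices of equal colour are either
  -- recoloured alike or both keep their old colour.
  override-injective : ∀ {k ℓ} (c : Fin n → Fin k) (g : Fin n → Maybe (Fin ℓ)) {u w} →
    override c g u ≡ override c g w → g u ≡ g w × (g u ≡ nothing → c u ≡ c w)
  override-injective {k} {ℓ} c g {u} {w} eq with g u | g w
  ... | just i  | just j  = cong just (Fin.↑ʳ-injective k i j eq) , λ ()
  ... | nothing | nothing = refl , λ _ → Fin.↑ˡ-injective ℓ (c u) (c w) eq
  ... | just i  | nothing with () ← trans (≡-sym (splitAt-↑ʳ k ℓ i))
                                      (trans (cong (splitAt k) eq) (splitAt-↑ˡ k (c w) ℓ))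
  ... | nothing | just j  with () ← trans (≡-sym (splitAt-↑ˡ k (c u) ℓ))
                                      (trans (cong (splitAt k) eq) (splitAt-↑ʳ k ℓ j))

  override-proper : ∀ {k ℓ} {c : Fin n → Fin k} {g : Fin n → Maybe (Fin ℓ)} →
    IsProperColoring G k c → PartialProper g → IsProperColoring G (k + ℓ) (override c g)
  override-proper {c = c} {g} proper gproper u v u~v eq with override-injective c g {u} {v} eq
  ... | gu≡gv , c≡ with g u in gu
  ...   | just i  = gproper u v i u~v gu (≡-sym gu≡gv)
  ...   | nothing = proper u v u~v (c≡ refl)

  override-just : ∀ {k ℓ} (c : Fin n → Fin k) (g : Fin n → Maybe (Fin ℓ)) {u i} →
    g u ≡ just i → override c g u ≡ k ↑ʳ i
  override-just {k} {ℓ} c g {u} gu = cong (Maybe.maybe (k ↑ʳ_) (c u ↑ˡ ℓ)) gu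

  -- The second round moves the vertices of `Y` to a second copy of their first-round colour, except
  -- for colour 0: hence `suc ℓ` new colours first and only `ℓ` afterwards.
  recolour-half : ∀ {k ℓ} (c : Fin n → Fin k) → IsProperColoring G k c →
    (H : Hitting ℓ (bad c)) (Y : Fin n → Bool) →
    (∀ v → T (bad (override c (Hitting.g H)) v) → ∀ b → ∃ λ u → Adj G v u × Y u ≢ b) →
    DynColorable G (k + suc ℓ + ℓ)
  recolour-half {k} {ℓ} c proper-c H Y splits =
    col , override-proper proper-ĉ proper-h , dynamic
    where
    open Hitting H

    ĉ : Fin n → Fin (k + suc ℓ)
    ĉ = override c g

    proper-ĉ : IsProperColoring G (k + suc ℓ) ĉ
    proper-ĉ = override-proper proper-c proper

    pred : Fin (suc ℓ) → Maybe (Fin ℓ)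
    pred zero    = nothing
    pred (suc i) = just i

    h : Fin n → Maybe (Fin ℓ)
    h u = if Y u then (g u Maybe.>>= pred) else nothing

    h-just : ∀ u {i} → h u ≡ just i → g u ≡ just (suc i)
    h-just u hu with Y u | g u
    h-just u refl | true | just (suc i) = refl

    h-nothing : ∀ u → Y u ≡ true → h u ≡ nothing → g u ≡ nothing ⊎ g u ≡ just zero
    h-nothing u _ hu with Y u | g u
    h-nothing u _ hu | true | nothing   = inj₁ refl
    h-nothing u _ hu | true | just zero = inj₂ refl

    proper-h : PartialProper h
    proper-h u v i u~v hu hv = proper u v (suc i) u~v (h-just u hu) (h-just v hv)

    col : Fin n → Fin (k + suc ℓ + ℓ)
    col = override ĉ h

    -- A colour of `h` determines the colour of `g` it was split from, so the second round creates
    -- no new monochromatic neighbourhood.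
    refines : ∀ {u w} → col u ≡ col w → ĉ u ≡ ĉ w
    refines {u} {w} eq with override-injective ĉ h {u} {w} eq
    ... | hu≡hw , ĉ≡ with h u in hu
    ...   | nothing = ĉ≡ refl
    ...   | just i  = trans (override-just c g (h-just u hu))
                            (≡-sym (override-just c g (h-just w (≡-sym hu≡hw))))

    ¬mono : ∀ v → ¬ Monochromatic col v
    ¬mono v mono with splits v v-bad false | splits v v-bad true
      where
      v-bad : T (bad ĉ v)
      v-bad = mono⇒bad ĉ v λ u w v~u v~w → refines (mono u w v~u v~w)
    -- Here `x` is in `Y` and `y` is not. As `h` skips `y` and both have the same final colour, it
    -- skips `x` too, so `g x` is `nothing` or colour 0.
    ... | x , v~x , x∈Y | y , v~y , y∉Y with h-nothing x (Y≡true x∈Y) hx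
      where
      Y≡true : ∀ {b} → b ≢ false → b ≡ true
      Y≡true {true}  _  = refl
      Y≡true {false} ≢f = ⊥-elim (≢f refl)
      hy : ∀ {b} {m : Maybe (Fin ℓ)} → b ≢ true → (if b then m else nothing) ≡ nothing
      hy {false} _  = refl
      hy {true}  ≢t = ⊥-elim (≢t refl)
      hx : h x ≡ nothing
      hx = trans (proj₁ (override-injective ĉ h (mono x y v~x v~y))) (hy y∉Y)
    -- Then `y` has colour 0 as well, so `x` and `y` coincide, although `Y` separates them.
    ...   | inj₂ gx≡0 = Y-constant (at-most-one x y gx≡0
              (trans (≡-sym (proj₁ (override-injective c g (refines (mono x y v~x v~y))))) gx≡0))
      where
      Y-constant : x ≢ y
      Y-constant refl = both (Y x) x∈Y y∉Y
        where
        both : ∀ b → b ≢ false → ¬ b ≢ true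
        both true  _  ≢t = ≢t refl
        both false ≢f _  = ≢f refl
    -- If `x` keeps its colour under `c`, so do all neighbours of `v`; then `v` is bad for `c`, yet
    -- `g` recolours one of its neighbours.
    ...   | inj₁ gx≡∅ with hits v (mono⇒bad c v λ u w v~u v~w →
                                  trans (≡-sym (c-of u v~u)) (c-of w v~w))
      where
      c-of : ∀ u → Adj G v u → c x ≡ c u
      c-of u v~u = proj₂ (override-injective c g (refines (mono x u v~x v~u))) gx≡∅
    ...     | z , v~z , gz≢∅ = gz≢∅
              (trans (≡-sym (proj₁ (override-injective c g (refines (mono x z v~x v~z))))) gx≡∅)

    dynamic : ∀ v → 2 ≤ degree G v → Dichromatic col v
    dynamic v _ = decidable-stable (dichromatic? col v) λ ¬di →
      ¬mono v (¬dichromatic⇒mono col v ¬di)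

  -- Both colourings have fewer than 2 ^ (ℓ + 1) bad vertices: for `c` this feeds `hitting`, and for
  -- `ĉ` twice their number is below 2 ^ (ℓ + 2), hence below 2 ^ r, as splitting requires.
  large-degree : ∀ {r α k} ℓ → Regular G r → 2 ≤ r → IsIndependenceNumber G α →
    α < 2 ^ ℓ → suc (suc ℓ) ≤ r → Colorable G k → DynColorable G (k + suc ℓ + ℓ)
  large-degree {r} {α} ℓ reg 2≤r isα α<2^ ℓ+2≤r (c , proper-c) = recolour-half c proper-c H Y splits
    where
    double< : ∀ {a k} → a < 2 ^ k → a + a < 2 ^ suc k
    double< a<2^ = +-mono-<-≤ a<2^ (≤-trans (<⇒≤ a<2^) (m≤m+n _ 0))

    bad< : ∀ {k} (c : Fin n → Fin k) → IsProperColoring G k c → count (bad c) < 2 ^ suc ℓ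
    bad< c proper = ≤-<-trans (few-bad c proper isα) (double< {k = ℓ} α<2^)

    H : Hitting ℓ (bad c)
    H = hitting reg 2≤r ℓ (bad c) (bad< c proper-c)

    ĉ = override c (Hitting.g H)

    splitting = split-neighbourhoods reg (bad ĉ)
      (≤-trans (double< {k = suc ℓ} (bad< ĉ (override-proper proper-c (Hitting.proper H))))
               (^-monoʳ-≤ 2 ℓ+2≤r))
    Y      = proj₁ splitting
    splits = proj₂ splitting

-- Greedy colouring for small degree.

fresh : ∀ {D} (xs : List (Fin (suc D))) → length xs ≤ D → ∃ λ k → ¬ k List.∈ xs
-- If every colour occurred, their positions would inject `suc D` colours into at most `D` places.
fresh {D} xs ∣xs∣≤D = ¬∀⟶∃¬ (suc D) (List._∈ xs) (_∈? xs) λ all → <⇒≱ (s≤s ∣xs∣≤D)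
  (injective⇒≤ {f = index ∘ all} λ {i} {j} eq → trans (lookup-index (all i))
    (trans (cong (List.lookup xs) eq) (≡-sym (lookup-index (all j)))))
  where open DecMembership _≟_ using (_∈?_)

-- Vertices are coloured one at a time, each avoiding the colours on its own list. Either vertex of
-- a pair may come later, so each must list the other.
greedy-colouring : ∀ {D} (conflicts : Fin n → List (Fin n)) →
  (∀ x → length (conflicts x) ≤ D) → Σ (Fin n → Fin (suc D)) λ c →
  ∀ x y → x ≢ y → y List.∈ conflicts x → x List.∈ conflicts y → c x ≢ c y
greedy-colouring {n} {D} conflicts bounded with colour (List.allFin n)
  where
  colour : ∀ xs → Σ (Fin n → Fin (suc D)) λ c → ∀ x y → x List.∈ xs → y List.∈ xs →
    x ≢ y → y List.∈ conflicts x → x List.∈ conflicts y → c x ≢ c y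
  -- Colour 0 is a placeholder: the claim covers processed vertices only.
  colour []       = (λ _ → zero) , λ _ _ ()
  colour (z ∷ zs) with colour zs
  ... | c , proper with fresh (List.map c (conflicts z))
                          (subst (_≤ D) (≡-sym (length-map c (conflicts z))) (bounded z))
  ...   | k , k∉ = c′ , proper′
    where
    c′ : Fin n → Fin (suc D)
    c′ u = if does (u ≟ z) then k else c u
    k≢c : ∀ {y} → y List.∈ conflicts z → k ≢ c y
    k≢c y∈ k≡cy = k∉ (subst (List._∈ _) (≡-sym k≡cy) (∈-map⁺ c y∈))
    older : ∀ {x} → x List.∈ z ∷ zs → x ≢ z → x List.∈ zs
    older (here x≡z) x≢z = ⊥-elim (x≢z x≡z)
    older (there x∈) _   = x∈
    proper′ : ∀ x y → x List.∈ z ∷ zs → y List.∈ z ∷ zs →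
      x ≢ y → y List.∈ conflicts x → x List.∈ conflicts y → c′ x ≢ c′ y
    proper′ x y x∈ y∈ x≢y xy yx with x ≟ z | y ≟ z
    ... | yes refl | yes refl = ⊥-elim (x≢y refl)
    ... | yes refl | no _     = k≢c xy
    ... | no _     | yes refl = k≢c yx ∘ ≡-sym
    ... | no x≢z   | no y≢z   = proper x y (older x∈ x≢z) (older y∈ y≢z) x≢y xy yx
... | c , proper = c , λ x y → proper x y (∈-allFin x) (∈-allFin y)

-- Every vertex v selects two of its neighbours, and these must also get different colours:
-- a vertex has at most one such conflict through each of its neighbours.
small-degree : ∀ {r} (G : Graph n) → Regular G r → 2 ≤ r → DynColorable G (suc (r + r))
small-degree {n} {r} G reg 2≤r = c , adjacent , selected
  where
  pair : ∀ v → ∃ λ a → ∃ λ b → Adj G v a × Adj G v b × a ≢ b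
  pair v = two-neighbours G v (subst (2 ≤_) (≡-sym (reg v)) 2≤r)

  p q : Fin n → Fin n
  p v = proj₁ (pair v)
  q v = proj₁ (proj₂ (pair v))

  -- The other vertex of the pair selected by `v` if `x` belongs to it; for any other `x` the value
  -- `p v` is a harmless extra conflict.
  partner : Fin n → Fin n → Fin n
  partner x v = if does (p v ≟ x) then q v else p v

  conflicts : Fin n → List (Fin n)
  conflicts x = neighbours G x ++ List.map (partner x) (neighbours G x)

  bounded : ∀ x → length (conflicts x) ≤ r + r
  bounded x = ≤-reflexive (trans (length-++ (neighbours G x))
    (cong₂ _+_ (reg x) (trans (length-map (partner x) (neighbours G x)) (reg x))))

  colouring = greedy-colouring conflicts bounded
  c         = proj₁ colouring

  adjacent : IsProperColoring G (suc (r + r)) c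
  adjacent u v u~v = proj₂ colouring u v (λ { refl → irreflexive G u~v })
    (∈-++⁺ˡ (Adj⇒∈ G u~v)) (∈-++⁺ˡ (Adj⇒∈ G (symmetric G u~v)))

  partner-conflicts : ∀ x v → Adj G v x → partner x v List.∈ conflicts x
  partner-conflicts x v v~x =
    ∈-++⁺ʳ (neighbours G x) (∈-map⁺ (partner x) (Adj⇒∈ G (symmetric G v~x)))

  selected : ∀ v → 2 ≤ degree G v → Dichromatic G c v
  selected v _ with pair v | partner-conflicts (p v) v | partner-conflicts (q v) v
  ... | a , b , v~a , v~b , a≢b | b∈ | a∈ = a , b , v~a , v~b , proj₂ colouring a b a≢b
    (subst (λ d → (if d then b else a) List.∈ conflicts a) (dec-true (a ≟ a) refl) (b∈ v~a))
    (subst (λ d → (if d then b else a) List.∈ conflicts b) (dec-false (a ≟ b) a≢b) (a∈ v~b))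

-- The bound on the difference.

edge⇒2≤ : {G : Graph n} → ∀ {k} → Colorable G k → ∀ {u v} → Adj G u v → 2 ≤ k
edge⇒2≤ {k = zero}        (c , _) {u} _ with () ← c u
edge⇒2≤ {k = suc zero}    (c , proper) {u} {v} u~v = ⊥-elim (proper u v u~v (singleton (c u) (c v)))
  where
  singleton : (i j : Fin 1) → i ≡ j
  singleton zero zero = refl
edge⇒2≤ {k = suc (suc _)} _ _ = s≤s (s≤s z≤n)

theorem4 : ∀ {n r : ℕ} (G : Graph n) → Regular G r →
    ∀ {χ χ₂ α : ℕ} → IsChromaticNumber G χ → IsDynamicChromaticNumber G χ₂ →
    IsIndependenceNumber G α →
    χ₂ ∸ χ ≤ 2 * ⌊log₂ α ⌋ + 3
-- Without vertices, no colours are needed; in the other case `zero` is a vertex.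
theorem4 {zero} G reg {χ} {χ₂} _ (_ , min₂) _ =
  ≤-trans (m∸n≤m χ₂ χ) (≤-trans (min₂ 0 ((λ ()) , (λ ()) , λ ())) z≤n)
theorem4 {suc n} {r} G reg {χ} {χ₂} {α} (colourable , _) (_ , min₂) isα
  with 2 ≤? r
-- All degrees are below 2, so every proper colouring is dynamic.
... | no 2≰r = ≤-trans (≤-reflexive (m≤n⇒m∸n≡0 (min₂ χ dynamic))) z≤n
  where
  dynamic : DynColorable G χ
  dynamic = proj₁ colourable , proj₂ colourable , λ v 2≤d →
    ⊥-elim (2≰r (subst (2 ≤_) (reg v) 2≤d))
... | yes 2≤r = m≤n+o⇒m∸n≤o χ₂ χ χ₂≤
  where
  open ≤-Reasoning
  L = ⌊log₂ α ⌋

  χ≥2 : 2 ≤ χ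
  χ≥2 with two-neighbours G zero (subst (2 ≤_) (≡-sym (reg zero)) 2≤r)
  ... | _ , _ , 0~a , _ = edge⇒2≤ {G = G} colourable 0~a

  χ₂≤ : χ₂ ≤ χ + (2 * L + 3)
  χ₂≤ with r ≤? 2 + L
  -- Here 2r + 1 is at most 2L + 5, and χ ≥ 2 absorbs the excess over 2L + 3.
  ... | yes r≤2+L = begin
    χ₂                      ≤⟨ min₂ _ (small-degree G reg 2≤r) ⟩
    suc (r + r)             ≤⟨ s≤s (+-mono-≤ r≤2+L r≤2+L) ⟩
    suc (2 + L + (2 + L))   ≡⟨ solve 1 (λ l → con 1 :+ (con 2 :+ l :+ (con 2 :+ l)) :=
                                 con 2 :+ (con 2 :* l :+ con 3)) refl L ⟩
    2 + (2 * L + 3)         ≤⟨ +-monoˡ-≤ (2 * L + 3) χ≥2 ⟩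
    χ + (2 * L + 3)         ∎
    where open +-*-Solver
  -- With `ℓ` equal to L + 1, the 2ℓ + 1 extra colours are exactly 2L + 3.
  ... | no r≰2+L = begin
    χ₂                      ≤⟨ min₂ _ (large-degree G (suc L) reg 2≤r isα (<2^[1+⌊log₂⌋] α)
                                 (≰⇒> r≰2+L) colourable) ⟩
    χ + suc (suc L) + suc L ≡⟨ solve 2 (λ x l → x :+ (con 2 :+ l) :+ (con 1 :+ l) :=
                                 x :+ (con 2 :* l :+ con 3)) refl χ L ⟩
    χ + (2 * L + 3)         ∎
    where open +-*-Solver
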